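{- Let $n\geq 1$, let $V$ be an $n$-dimensional vector space over $\mathbb{C}$, and let $A(z)=\sum_{m=0}^\infty A_m z^m\in \mathrm{End}(V)[[z]]$, with $A_m\in M_{n,n}(\mathbb{C})$, be such that $A_0$ is similar to a single $n\times n$ Jordan block with eigenvalue $0$. Then for every fixed integer $k\geq 1$ there exist $g_0\in \mathrm{GL}_n(\mathbb{C})$ and $g_1,\ldots,g_k\in M_{n,n}(\mathbb{C})$ such that, setting \[ g(z)=(I_n+g_kz^k)(I_n+g_{k-1}z^{k-1})\cdots(I_n+g_1z)\,g_0, \] the coefficients of $g(z)A(z)g(z)^{ -1}=B(z)=\sum_{m=0}^\infty B_m z^m$ satisfy the following: (i) $B_0$ is the upper triangular nilpotent Jordan block of size $n$, i.e. $(B_0)_{i,i+1}=1$ for $1\leq i\leq n-1$ and all other entries of $B_0$ are $0$; (ii) for every $1\leq \ell\leq k$, all entries of $B_\ell$ outside the $n$-th (last) row are $0$; that is, $B_\ell$ has the form \[ B_\ell= \begin{pmatrix} 0 & 0 & \cdots & 0 & 0\\ \vdots & \vdots & \ddots & \vdots & \vdots\\ 0 & 0 & \cdots & 0 & 0\\ b_{n(\ell-1)+1} & b_{n(\ell-1)+2} & \cdots & b_{n\ell-1} & b_{n\ell} \end{pmatrix} \] for some complex numbers $b_{n(\ell-1)+1},\ldots,b_{n\ell}$.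
   Context: $\mathrm{End}(V)[[z]]$ is the ring of formal power series in $z$ with coefficients in $\mathrm{End}(V)$, identified with $M_{n,n}(\mathbb{C})$ by a choice of basis. An element of this ring is invertible if and only if its constant term is invertible; in particular the polynomial $g(z)$ in the claim is invertible, and $g(z)^{ -1}$ denotes its inverse in $\mathrm{End}(V)[[z]]$. -}

module Defs where

open import Algebra.Bundles using (RawRing)
import Algebra.Definitions
import Algebra.Definitions.RawMonoid as RawMonoidDefinitions
open import Data.Bool.Base using (if_then_else_)
open import Data.Fin.Base using (Fin; toℕ)
import Data.Fin.Properties as Fin
open import Data.Nat.Base as ℕ using (ℕ; zero; suc)
import Data.Nat.Properties as ℕ
open import Data.Product.Base using (Σ-syntax; ∃-syntax; _×_; _,_; proj₁)
open import Data.Rational.Base as ℚ using (ℚ; 0ℚ; 1ℚ; ½; ∣_∣; _<_)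
import Data.Rational.Properties as ℚ
open import Data.Rational.Solver using (module +-*-Solver)
open import Data.Vec.Functional using (Vector; init; last)
open import Level using (Level; 0ℓ; _⊔_)
open import Relation.Binary.PropositionalEquality
  using (_≡_; refl; sym; cong; subst; module ≡-Reasoning)
open import Relation.Nullary.Decidable using (does)

private
  variable
    c ℓ : Level
    k : ℕ

------------------------------------------------------------------------
-- The real numbers, as Cauchy sequences of rationals.  No quotient is
-- taken: equality of reals is the relation _≈ℝ_ below.

IsCauchy : (ℕ → ℚ) → Set
IsCauchy x = ∀ ε → 0ℚ < ε →
  ∃[ N ] ∀ m n → N ℕ.≤ m → N ℕ.≤ n → ∣ x m ℚ.- x n ∣ < ε

record ℝ : Set where
  constructor mkℝ
  field
    seq    : ℕ → ℚ
    cauchy : IsCauchy seq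

open ℝ public

infix 4 _≈ℝ_

_≈ℝ_ : ℝ → ℝ → Set
x ≈ℝ y = ∀ ε → 0ℚ < ε →
  ∃[ N ] ∀ n → N ℕ.≤ n → ∣ seq x n ℚ.- seq y n ∣ < ε

half-pos : ∀ {ε} → 0ℚ < ε → 0ℚ < ½ ℚ.* ε
half-pos {ε} 0<ε =
  ℚ.positive⁻¹ _ {{ℚ.pos*pos⇒pos ½ ε {{ℚ.positive 0<ε}}}}

half+half : ∀ ε → ½ ℚ.* ε ℚ.+ ½ ℚ.* ε ≡ ε
half+half ε = begin
  ½ ℚ.* ε ℚ.+ ½ ℚ.* ε  ≡⟨ ℚ.*-distribʳ-+ ε ½ ½ ⟨
  1ℚ ℚ.* ε             ≡⟨ ℚ.*-identityˡ ε ⟩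
  ε                    ∎
  where open ≡-Reasoning

const-cauchy : ∀ q → IsCauchy (λ _ → q)
const-cauchy q ε 0<ε = 0 , λ _ _ _ _ →
  subst (_< ε) (sym (cong ∣_∣ (ℚ.+-inverseʳ q))) 0<ε

+-cauchy : ∀ {x y} → IsCauchy x → IsCauchy y →
           IsCauchy (λ n → x n ℚ.+ y n)
+-cauchy {x} {y} cx cy ε 0<ε
  with cx (½ ℚ.* ε) (half-pos 0<ε) | cy (½ ℚ.* ε) (half-pos 0<ε)
... | M , p | N , q = M ℕ.⊔ N , λ m n m≥ n≥ → begin-strict
  ∣ (x m ℚ.+ y m) ℚ.- (x n ℚ.+ y n) ∣
    ≡⟨ cong ∣_∣ (rearrange (x m) (y m) (x n) (y n)) ⟩
  ∣ (x m ℚ.- x n) ℚ.+ (y m ℚ.- y n) ∣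
    ≤⟨ ℚ.∣p+q∣≤∣p∣+∣q∣ (x m ℚ.- x n) (y m ℚ.- y n) ⟩
  ∣ x m ℚ.- x n ∣ ℚ.+ ∣ y m ℚ.- y n ∣
    <⟨ ℚ.+-mono-<
         (p m n (ℕ.m⊔n≤o⇒m≤o M N m≥) (ℕ.m⊔n≤o⇒m≤o M N n≥))
         (q m n (ℕ.m⊔n≤o⇒n≤o M N m≥) (ℕ.m⊔n≤o⇒n≤o M N n≥)) ⟩
  ½ ℚ.* ε ℚ.+ ½ ℚ.* ε
    ≡⟨ half+half ε ⟩
  ε ∎
  where
  open ℚ.≤-Reasoning
  open +-*-Solver
  rearrange : ∀ a b c d →
    (a ℚ.+ b) ℚ.- (c ℚ.+ d) ≡ (a ℚ.- c) ℚ.+ (b ℚ.- d)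
  rearrange = solve 4
    (λ a b c d → (a :+ b) :- (c :+ d) := (a :- c) :+ (b :- d)) refl

neg-cauchy : ∀ {x} → IsCauchy x → IsCauchy (λ n → ℚ.- x n)
neg-cauchy {x} cx ε 0<ε with cx ε 0<ε
... | N , p = N , λ m n m≥ n≥ → begin-strict
  ∣ ℚ.- x m ℚ.- ℚ.- x n ∣  ≡⟨ cong ∣_∣ (ℚ.neg-distrib-+ (x m) (ℚ.- x n)) ⟨
  ∣ ℚ.- (x m ℚ.- x n) ∣    ≡⟨ ℚ.∣-p∣≡∣p∣ (x m ℚ.- x n) ⟩
  ∣ x m ℚ.- x n ∣          <⟨ p m n m≥ n≥ ⟩
  ε                        ∎
  where open ℚ.≤-Reasoning

eventually-bounded : ∀ {x} → IsCauchy x →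
  ∃[ K ] 0ℚ < K × ∃[ N ] ∀ n → N ℕ.≤ n → ∣ x n ∣ < K
eventually-bounded {x} cx with cx 1ℚ (ℚ.positive⁻¹ 1ℚ)
... | N , p = 1ℚ ℚ.+ ∣ x N ∣ , 0<K , N , λ n n≥ → begin-strict
  ∣ x n ∣
    ≡⟨ cong ∣_∣ (split (x n) (x N)) ⟩
  ∣ (x n ℚ.- x N) ℚ.+ x N ∣
    ≤⟨ ℚ.∣p+q∣≤∣p∣+∣q∣ (x n ℚ.- x N) (x N) ⟩
  ∣ x n ℚ.- x N ∣ ℚ.+ ∣ x N ∣
    <⟨ ℚ.+-monoˡ-< ∣ x N ∣ (p n N n≥ ℕ.≤-refl) ⟩
  1ℚ ℚ.+ ∣ x N ∣ ∎
  where
  open ℚ.≤-Reasoning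
  open +-*-Solver
  0<K : 0ℚ < 1ℚ ℚ.+ ∣ x N ∣
  0<K = ℚ.positive⁻¹ _
    {{ℚ.pos+nonNeg⇒pos 1ℚ ∣ x N ∣ {{ℚ.∣-∣-nonNeg (x N)}}}}
  split : ∀ a b → a ≡ (a ℚ.- b) ℚ.+ b
  split = solve 2 (λ a b → a := (a :- b) :+ b) refl

product-bound : ∀ {a b C δ} → 0ℚ < C → ∣ a ∣ < C → ∣ b ∣ < δ →
                ∣ a ℚ.* b ∣ < C ℚ.* δ
product-bound {a} {b} {C} {δ} 0<C a<C b<δ = begin-strict
  ∣ a ℚ.* b ∣
    ≡⟨ ℚ.∣p*q∣≡∣p∣*∣q∣ a b ⟩
  ∣ a ∣ ℚ.* ∣ b ∣
    ≤⟨ ℚ.*-monoʳ-≤-nonNeg ∣ b ∣ {{ℚ.∣-∣-nonNeg b}} (ℚ.<⇒≤ a<C) ⟩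
  C ℚ.* ∣ b ∣
    <⟨ ℚ.*-monoʳ-<-pos C {{ℚ.positive 0<C}} b<δ ⟩
  C ℚ.* δ ∎
  where open ℚ.≤-Reasoning

split-proportionally : ∀ {ε K L} → 0ℚ < ε → 0ℚ < K → 0ℚ < L →
  ∃[ δ ] 0ℚ < δ × K ℚ.* δ ℚ.+ L ℚ.* δ ≡ ε
split-proportionally {ε} {K} {L} 0<ε 0<K 0<L =
  ε ℚ.* r , ℚ.positive⁻¹ (ε ℚ.* r) {{εr-pos}} , (begin
    K ℚ.* (ε ℚ.* r) ℚ.+ L ℚ.* (ε ℚ.* r)
      ≡⟨ ℚ.*-distribʳ-+ (ε ℚ.* r) K L ⟨
    (K ℚ.+ L) ℚ.* (ε ℚ.* r)
      ≡⟨ cong ((K ℚ.+ L) ℚ.*_) (ℚ.*-comm ε r) ⟩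
    (K ℚ.+ L) ℚ.* (r ℚ.* ε)
      ≡⟨ ℚ.*-assoc (K ℚ.+ L) r ε ⟨
    ((K ℚ.+ L) ℚ.* r) ℚ.* ε
      ≡⟨ cong (ℚ._* ε) (ℚ.*-inverseʳ (K ℚ.+ L) {{K+L-nonZero}}) ⟩
    1ℚ ℚ.* ε
      ≡⟨ ℚ.*-identityˡ ε ⟩
    ε ∎)
  where
  open ≡-Reasoning
  K+L-pos : ℚ.Positive (K ℚ.+ L)
  K+L-pos = ℚ.pos+pos⇒pos K {{ℚ.positive 0<K}} L {{ℚ.positive 0<L}}
  K+L-nonZero : ℚ.NonZero (K ℚ.+ L)
  K+L-nonZero = ℚ.pos⇒nonZero (K ℚ.+ L) {{K+L-pos}}
  r : ℚ
  r = (ℚ.1/ (K ℚ.+ L)) {{K+L-nonZero}}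
  εr-pos : ℚ.Positive (ε ℚ.* r)
  εr-pos = ℚ.pos*pos⇒pos ε {{ℚ.positive 0<ε}}
             r {{ℚ.1/pos⇒pos (K ℚ.+ L) {{K+L-pos}}}}

product-distance : ∀ {a b c d K L δ} → 0ℚ < K → 0ℚ < L →
  ∣ a ∣ < K → ∣ d ∣ < L → ∣ a ℚ.- c ∣ < δ → ∣ b ℚ.- d ∣ < δ →
  ∣ a ℚ.* b ℚ.- c ℚ.* d ∣ < K ℚ.* δ ℚ.+ L ℚ.* δ
product-distance {a} {b} {c} {d} {K} {L} {δ} 0<K 0<L a<K d<L ac bd =
  begin-strict
  ∣ a ℚ.* b ℚ.- c ℚ.* d ∣
    ≡⟨ cong ∣_∣ (rearrange a b c d) ⟩
  ∣ a ℚ.* (b ℚ.- d) ℚ.+ d ℚ.* (a ℚ.- c) ∣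
    ≤⟨ ℚ.∣p+q∣≤∣p∣+∣q∣ (a ℚ.* (b ℚ.- d)) (d ℚ.* (a ℚ.- c)) ⟩
  ∣ a ℚ.* (b ℚ.- d) ∣ ℚ.+ ∣ d ℚ.* (a ℚ.- c) ∣
    <⟨ ℚ.+-mono-< (product-bound {a} {b ℚ.- d} {K} {δ} 0<K a<K bd)
                  (product-bound {d} {a ℚ.- c} {L} {δ} 0<L d<L ac) ⟩
  K ℚ.* δ ℚ.+ L ℚ.* δ ∎
  where
  open ℚ.≤-Reasoning
  open +-*-Solver
  rearrange : ∀ a b c d →
    a ℚ.* b ℚ.- c ℚ.* d ≡ a ℚ.* (b ℚ.- d) ℚ.+ d ℚ.* (a ℚ.- c)
  rearrange = solve 4
    (λ a b c d → a :* b :- c :* d := a :* (b :- d) :+ d :* (a :- c)) refl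

*-cauchy : ∀ {x y} → IsCauchy x → IsCauchy y →
           IsCauchy (λ n → x n ℚ.* y n)
*-cauchy {x} {y} cx cy ε 0<ε =
  let K , 0<K , M₁ , bx = eventually-bounded {x} cx
      L , 0<L , N₁ , by = eventually-bounded {y} cy
      δ , 0<δ , Kδ+Lδ≡ε = split-proportionally {ε} {K} {L} 0<ε 0<K 0<L
      M₂ , p = cx δ 0<δ
      N₂ , q = cy δ 0<δ
  in (M₁ ℕ.⊔ N₁) ℕ.⊔ (M₂ ℕ.⊔ N₂) , λ m n m≥ n≥ →
  let m≥₁ = ℕ.m⊔n≤o⇒m≤o (M₁ ℕ.⊔ N₁) (M₂ ℕ.⊔ N₂) m≥
      m≥₂ = ℕ.m⊔n≤o⇒n≤o (M₁ ℕ.⊔ N₁) (M₂ ℕ.⊔ N₂) m≥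
      n≥₁ = ℕ.m⊔n≤o⇒m≤o (M₁ ℕ.⊔ N₁) (M₂ ℕ.⊔ N₂) n≥
      n≥₂ = ℕ.m⊔n≤o⇒n≤o (M₁ ℕ.⊔ N₁) (M₂ ℕ.⊔ N₂) n≥
  in subst (∣ x m ℚ.* y m ℚ.- x n ℚ.* y n ∣ <_) Kδ+Lδ≡ε
       (product-distance {x m} {y m} {x n} {y n} {K} {L} {δ} 0<K 0<L
         (bx m (ℕ.m⊔n≤o⇒m≤o M₁ N₁ m≥₁))
         (by n (ℕ.m⊔n≤o⇒n≤o M₁ N₁ n≥₁))
         (p m n (ℕ.m⊔n≤o⇒m≤o M₂ N₂ m≥₂) (ℕ.m⊔n≤o⇒m≤o M₂ N₂ n≥₂))
         (q m n (ℕ.m⊔n≤o⇒n≤o M₂ N₂ m≥₂) (ℕ.m⊔n≤o⇒n≤o M₂ N₂ n≥₂)))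

ℝ-rawRing : RawRing 0ℓ 0ℓ
ℝ-rawRing = record
  { Carrier = ℝ
  ; _≈_     = _≈ℝ_
  ; _+_     = λ x y → mkℝ (λ n → seq x n ℚ.+ seq y n)
                          (+-cauchy {seq x} {seq y} (cauchy x) (cauchy y))
  ; _*_     = λ x y → mkℝ (λ n → seq x n ℚ.* seq y n)
                          (*-cauchy {seq x} {seq y} (cauchy x) (cauchy y))
  ; -_      = λ x → mkℝ (λ n → ℚ.- seq x n) (neg-cauchy {seq x} (cauchy x))
  ; 0#      = mkℝ (λ _ → 0ℚ) (const-cauchy 0ℚ)
  ; 1#      = mkℝ (λ _ → 1ℚ) (const-cauchy 1ℚ)
  }

-- The complex numbers; (a , b) stands for a + b i.

ℂ : RawRing 0ℓ 0ℓ
ℂ = record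
  { Carrier = ℝ × ℝ
  ; _≈_     = λ (a , b) (c , d) → a ≈ c × b ≈ d
  ; _+_     = λ (a , b) (c , d) → (a + c , b + d)
  ; _*_     = λ (a , b) (c , d) → (a * c + - (b * d) , a * d + b * c)
  ; -_      = λ (a , b) → (- a , - b)
  ; 0#      = (0# , 0#)
  ; 1#      = (1# , 0#)
  }
  where open RawRing ℝ-rawRing

------------------------------------------------------------------------
-- Matrices and formal power series.  Only the operations are needed to
-- state results, so both constructions act on raw rings; coefficients
-- of power series need not commute.

matrixRing : RawRing c ℓ → ℕ → RawRing c ℓ
matrixRing R n = record
  { Carrier = Fin n → Fin n → Carrier
  ; _≈_     = λ A B → ∀ i j → A i j ≈ B i j
  ; _+_     = λ A B i j → A i j + B i j
  ; _*_     = λ A B i j → sum (λ l → A i l * B l j)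
  ; -_      = λ A i j → - A i j
  ; 0#      = λ _ _ → 0#
  ; 1#      = λ i j → if does (i Fin.≟ j) then 1# else 0#
  }
  where
  open RawRing R
  open RawMonoidDefinitions +-rawMonoid using (sum)

monomial : (R : RawRing c ℓ) → ℕ → RawRing.Carrier R → ℕ → RawRing.Carrier R
monomial R d a m = if does (m ℕ.≟ d) then a else RawRing.0# R

powerSeriesRing : RawRing c ℓ → RawRing c ℓ
powerSeriesRing R = record
  { Carrier = ℕ → Carrier
  ; _≈_     = λ a b → ∀ m → a m ≈ b m
  ; _+_     = λ a b m → a m + b m
  ; _*_     = λ a b m →
                sum {suc m} (λ i → a (toℕ i) * b (m ℕ.∸ toℕ i))
  ; -_      = λ a m → - a m
  ; 0#      = λ _ → 0#
  ; 1#      = monomial R 0 1#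
  }
  where
  open RawRing R
  open RawMonoidDefinitions +-rawMonoid using (sum)

-- Two-sided invertibility; the first component of a proof is the inverse.

Invertible : (R : RawRing c ℓ) → RawRing.Carrier R → Set (c ⊔ ℓ)
Invertible R = Algebra.Definitions.Invertible _≈_ 1# _*_
  where open RawRing R

Similar : (R : RawRing c ℓ) (n : ℕ) (A B : RawRing.Carrier (matrixRing R n)) →
          Set (c ⊔ ℓ)
Similar R n A B =
  ∃[ P ] Σ[ P-inv ∈ Invertible (matrixRing R n) P ]
    P * A * proj₁ P-inv ≈ B
  where open RawRing (matrixRing R n)

-- The upper triangular Jordan block with eigenvalue μ.

jordanBlock : (R : RawRing c ℓ) (n : ℕ) → RawRing.Carrier R →
              RawRing.Carrier (matrixRing R n)
jordanBlock R n μ i j =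
  if does (i Fin.≟ j) then μ
  else if does (toℕ j ℕ.≟ suc (toℕ i)) then 1# else 0#
  where open RawRing R

-- (1 + gₖ zᵏ) ⋯ (1 + g₁ z) g₀.  The vector is indexed from 0, so gⱼ is
-- its entry at position j - 1, and the leftmost factor uses its last entry.

gaugeProduct : (R : RawRing c ℓ) → RawRing.Carrier R →
               Vector (RawRing.Carrier R) k →
               RawRing.Carrier (powerSeriesRing R)
gaugeProduct {k = zero}  R g₀ g = monomial R 0 g₀
gaugeProduct {k = suc k} R g₀ g =
  (1# + monomial R (suc k) (last g)) * gaugeProduct R g₀ (init g)
  where open RawRing (powerSeriesRing R)

-- Let g₀ conjugate A₀ to the Jordan block J.  Conjugation by 1 + x zᵏ leaves
-- the coefficients below degree k unchanged and replaces Bₖ by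
-- Bₖ + x J - J x, so it is enough to choose x at each degree in turn such that
-- this sum vanishes outside the last row.  As J shifts the rows of x up by
-- one, that condition determines each row of x from the previous one.
module Submission where

open import Defs
open import Algebra.Bundles using (RawRing; Ring; AbelianGroup)
open import Algebra.Structures using (IsRing)
import Algebra.Construct.DirectProduct as DirectProduct
import Algebra.Construct.Pointwise as Pointwise
import Algebra.Properties.Semiring.Sum as Sum
open import Data.Fin.Base using (Fin; zero; suc; toℕ; fromℕ; inject₁; lower₁; punchIn)
import Data.Fin.Properties as Fin
open import Data.Nat.Base using (ℕ; zero; suc; _∸_; _⊔_; _≤_; _<_; z≤n; s≤s)
import Data.Nat.Properties as ℕ
open import Data.Product.Base using (Σ-syntax; _×_; _,_; proj₁; proj₂)
open import Data.Rational.Base as ℚ using (ℚ; 0ℚ; 1ℚ; ½; ∣_∣)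
import Data.Rational.Properties as ℚ
open import Data.Rational.Solver using (module +-*-Solver)
open import Data.Sum.Base using (inj₁; inj₂)
open import Data.Vec.Functional using (Vector; init; last; insertAt)
open import Data.Vec.Functional.Properties using (insertAt-lookup; insertAt-punchIn)
open import Function.Base using (_∘_)
open import Level using (0ℓ)
import Relation.Binary.Reasoning.Setoid as SetoidReasoning
open import Relation.Binary.PropositionalEquality as ≡ using (_≡_; _≢_)

-- The ring of complex numbers

-- The operations on reals act termwise, so every ring law reduces to an identity of rationals at
-- each index; this carries such identities over to `_≈ℝ_`.
≗⇒≈ℝ : ∀ x y → (∀ n → seq x n ≡ seq y n) → x ≈ℝ y
≗⇒≈ℝ x y x≗y ε 0<ε = 0 , λ n _ →
  ≡.subst (ℚ._< ε) (≡.sym (≡.cong ∣_∣ (xₙ-yₙ≡0 n))) 0<ε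
  where
  xₙ-yₙ≡0 : ∀ n → seq x n ℚ.- seq y n ≡ 0ℚ
  xₙ-yₙ≡0 n = ≡.trans (≡.cong (ℚ._- seq y n) (x≗y n)) (ℚ.+-inverseʳ (seq y n))

≈ℝ-sym : ∀ x y → x ≈ℝ y → y ≈ℝ x
≈ℝ-sym x y x≈y ε 0<ε =
  let N , p = x≈y ε 0<ε
  in N , λ n n≥ → ≡.subst (ℚ._< ε) (distance-comm (seq x n) (seq y n)) (p n n≥)
  where
  open +-*-Solver
  distance-comm : ∀ a b → ∣ a ℚ.- b ∣ ≡ ∣ b ℚ.- a ∣
  distance-comm a b = ≡.trans (≡.sym (ℚ.∣-p∣≡∣p∣ (a ℚ.- b)))
    (≡.cong ∣_∣ (solve 2 (λ a b → :- (a :- b) := b :- a) ≡.refl a b))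

-- The half-epsilon argument common to transitivity and to addition; `split` is the algebraic
-- identity in which these two uses differ.
distance-sum : ∀ {ε} a b c d e f → a ℚ.- b ≡ (c ℚ.- d) ℚ.+ (e ℚ.- f) →
  ∣ c ℚ.- d ∣ ℚ.< ½ ℚ.* ε → ∣ e ℚ.- f ∣ ℚ.< ½ ℚ.* ε → ∣ a ℚ.- b ∣ ℚ.< ε
distance-sum {ε} a b c d e f split p q = begin-strict
  ∣ a ℚ.- b ∣                      ≡⟨ ≡.cong ∣_∣ split ⟩
  ∣ (c ℚ.- d) ℚ.+ (e ℚ.- f) ∣      ≤⟨ ℚ.∣p+q∣≤∣p∣+∣q∣ (c ℚ.- d) (e ℚ.- f) ⟩
  ∣ c ℚ.- d ∣ ℚ.+ ∣ e ℚ.- f ∣      <⟨ ℚ.+-mono-< p q ⟩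
  ½ ℚ.* ε ℚ.+ ½ ℚ.* ε              ≡⟨ half+half ε ⟩
  ε                                ∎
  where open ℚ.≤-Reasoning

≈ℝ-trans : ∀ x y z → x ≈ℝ y → y ≈ℝ z → x ≈ℝ z
≈ℝ-trans x y z x≈y y≈z ε 0<ε =
  let M , p = x≈y (½ ℚ.* ε) (half-pos 0<ε)
      N , q = y≈z (½ ℚ.* ε) (half-pos 0<ε)
  in M ⊔ N , λ n n≥ →
     distance-sum (seq x n) (seq z n) (seq x n) (seq y n) (seq y n) (seq z n)
       (solve 3 (λ a b c → a :- c := (a :- b) :+ (b :- c)) ≡.refl
         (seq x n) (seq y n) (seq z n))
       (p n (ℕ.m⊔n≤o⇒m≤o M N n≥)) (q n (ℕ.m⊔n≤o⇒n≤o M N n≥))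
  where open +-*-Solver

module ℝ-raw = RawRing ℝ-rawRing

+ℝ-cong : ∀ x y u v → x ≈ℝ y → u ≈ℝ v → (x ℝ-raw.+ u) ≈ℝ (y ℝ-raw.+ v)
+ℝ-cong x y u v x≈y u≈v ε 0<ε =
  let M , p = x≈y (½ ℚ.* ε) (half-pos 0<ε)
      N , q = u≈v (½ ℚ.* ε) (half-pos 0<ε)
  in M ⊔ N , λ n n≥ →
     distance-sum (seq x n ℚ.+ seq u n) (seq y n ℚ.+ seq v n)
       (seq x n) (seq y n) (seq u n) (seq v n)
       (solve 4 (λ a b c d → (a :+ c) :- (b :+ d) := (a :- b) :+ (c :- d)) ≡.refl
         (seq x n) (seq y n) (seq u n) (seq v n))
       (p n (ℕ.m⊔n≤o⇒m≤o M N n≥)) (q n (ℕ.m⊔n≤o⇒n≤o M N n≥))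
  where open +-*-Solver

-ℝ-cong : ∀ x y → x ≈ℝ y → (ℝ-raw.- x) ≈ℝ (ℝ-raw.- y)
-ℝ-cong x y x≈y ε 0<ε =
  let N , p = x≈y ε 0<ε
  in N , λ n n≥ → ≡.subst (ℚ._< ε) (distance-neg (seq x n) (seq y n)) (p n n≥)
  where
  distance-neg : ∀ a b → ∣ a ℚ.- b ∣ ≡ ∣ (ℚ.- a) ℚ.- (ℚ.- b) ∣
  distance-neg a b = ≡.trans (≡.sym (ℚ.∣-p∣≡∣p∣ (a ℚ.- b)))
    (≡.cong ∣_∣ (ℚ.neg-distrib-+ a (ℚ.- b)))

-- From xu - yv = x(u - v) + v(x - y): bounds on `x` and `v` suffice, and `δ` is chosen so that the
-- two errors add up to `ε`.
*ℝ-cong : ∀ x y u v → x ≈ℝ y → u ≈ℝ v → (x ℝ-raw.* u) ≈ℝ (y ℝ-raw.* v)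
*ℝ-cong x y u v x≈y u≈v ε 0<ε =
  let K , 0<K , M₁ , bx = eventually-bounded {seq x} (cauchy x)
      L , 0<L , N₁ , bv = eventually-bounded {seq v} (cauchy v)
      δ , 0<δ , Kδ+Lδ≡ε = split-proportionally {ε} {K} {L} 0<ε 0<K 0<L
      M₂ , p = x≈y δ 0<δ
      N₂ , q = u≈v δ 0<δ
  in (M₁ ⊔ N₁) ⊔ (M₂ ⊔ N₂) , λ n n≥ →
  let n≥₁ = ℕ.m⊔n≤o⇒m≤o (M₁ ⊔ N₁) (M₂ ⊔ N₂) n≥
      n≥₂ = ℕ.m⊔n≤o⇒n≤o (M₁ ⊔ N₁) (M₂ ⊔ N₂) n≥
  in ≡.subst (∣ seq x n ℚ.* seq u n ℚ.- seq y n ℚ.* seq v n ∣ ℚ.<_) Kδ+Lδ≡ε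
       (product-distance {seq x n} {seq u n} {seq y n} {seq v n} {K} {L} {δ} 0<K 0<L
         (bx n (ℕ.m⊔n≤o⇒m≤o M₁ N₁ n≥₁))
         (bv n (ℕ.m⊔n≤o⇒n≤o M₁ N₁ n≥₁))
         (p n (ℕ.m⊔n≤o⇒m≤o M₂ N₂ n≥₂))
         (q n (ℕ.m⊔n≤o⇒n≤o M₂ N₂ n≥₂)))

ℝ-+-abelianGroup : AbelianGroup 0ℓ 0ℓ
ℝ-+-abelianGroup = record
  { Carrier = ℝ
  ; _≈_     = _≈ℝ_
  ; _∙_     = ℝ-raw._+_
  ; ε       = ℝ-raw.0#
  ; _⁻¹     = ℝ-raw.-_
  ; isAbelianGroup = record
    { isGroup = record
      { isMonoid = record
        { isSemigroup = record
          { isMagma = record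
            { isEquivalence = record
              { refl  = λ {x} → ≗⇒≈ℝ x x λ _ → ≡.refl
              ; sym   = λ {x} {y} → ≈ℝ-sym x y
              ; trans = λ {x} {y} {z} → ≈ℝ-trans x y z
              }
            ; ∙-cong = λ {x} {y} {u} {v} → +ℝ-cong x y u v
            }
          ; assoc = λ x y z → ≗⇒≈ℝ ((x + y) + z) (x + (y + z))
              λ n → ℚ.+-assoc (seq x n) (seq y n) (seq z n)
          }
        ; identity = (λ x → ≗⇒≈ℝ (0# + x) x λ n → ℚ.+-identityˡ (seq x n))
                   , (λ x → ≗⇒≈ℝ (x + 0#) x λ n → ℚ.+-identityʳ (seq x n))
        }
      ; inverse = (λ x → ≗⇒≈ℝ (- x + x) 0# λ n → ℚ.+-inverseˡ (seq x n))
                , (λ x → ≗⇒≈ℝ (x + - x) 0# λ n → ℚ.+-inverseʳ (seq x n))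
      ; ⁻¹-cong = λ {x} {y} → -ℝ-cong x y
      }
    ; comm = λ x y → ≗⇒≈ℝ (x + y) (y + x) λ n → ℚ.+-comm (seq x n) (seq y n)
    }
  }
  where open RawRing ℝ-rawRing using (_+_; -_; 0#)

ℂ-ring : Ring 0ℓ 0ℓ
ℂ-ring = record
  { Carrier = RawRing.Carrier ℂ
  ; _≈_     = RawRing._≈_ ℂ
  ; _+_     = _+_
  ; _*_     = _*_
  ; -_      = -_
  ; 0#      = 0#
  ; 1#      = 1#
  ; isRing  = record
    { +-isAbelianGroup = AbelianGroup.isAbelianGroup
        (DirectProduct.abelianGroup ℝ-+-abelianGroup ℝ-+-abelianGroup)
    ; *-cong = λ {(a , b)} {(c , d)} {(u , v)} {(w , z)} (a≈c , b≈d) (u≈w , v≈z) →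
          +ℝ-cong (a ℝ-raw.* u) (c ℝ-raw.* w) (ℝ-raw.- (b ℝ-raw.* v)) (ℝ-raw.- (d ℝ-raw.* z))
            (*ℝ-cong a c u w a≈c u≈w)
            (-ℝ-cong (b ℝ-raw.* v) (d ℝ-raw.* z) (*ℝ-cong b d v z b≈d v≈z))
        , +ℝ-cong (a ℝ-raw.* v) (c ℝ-raw.* z) (b ℝ-raw.* u) (d ℝ-raw.* w)
            (*ℝ-cong a c v z a≈c v≈z) (*ℝ-cong b d u w b≈d u≈w)
    -- In the identities of three variables x = a + bi, y = c + di and z = e + fi; the first call of
    -- the solver treats the real part, the second the imaginary part.
    ; *-assoc = λ x y z → ≗⇒≈ℂ ((x * y) * z) (x * (y * z))
        (λ n → solve 6 (λ a b c d e f →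
            (a :* c :- b :* d) :* e :- (a :* d :+ b :* c) :* f :=
            a :* (c :* e :- d :* f) :- b :* (c :* f :+ d :* e)) ≡.refl
          (re x n) (im x n) (re y n) (im y n) (re z n) (im z n))
        (λ n → solve 6 (λ a b c d e f →
            (a :* c :- b :* d) :* f :+ (a :* d :+ b :* c) :* e :=
            a :* (c :* f :+ d :* e) :+ b :* (c :* e :- d :* f)) ≡.refl
          (re x n) (im x n) (re y n) (im y n) (re z n) (im z n))
    ; *-identity =
        (λ x → ≗⇒≈ℂ (1# * x) x
          (λ n → solve 2 (λ a b → con 1ℚ :* a :- con 0ℚ :* b := a) ≡.refl (re x n) (im x n))
          (λ n → solve 2 (λ a b → con 1ℚ :* b :+ con 0ℚ :* a := b) ≡.refl (re x n) (im x n)))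
      , (λ x → ≗⇒≈ℂ (x * 1#) x
          (λ n → solve 2 (λ a b → a :* con 1ℚ :- b :* con 0ℚ := a) ≡.refl (re x n) (im x n))
          (λ n → solve 2 (λ a b → a :* con 0ℚ :+ b :* con 1ℚ := b) ≡.refl (re x n) (im x n)))
    ; distrib =
        (λ x y z → ≗⇒≈ℂ (x * (y + z)) (x * y + x * z)
          (λ n → solve 6 (λ a b c d e f →
              a :* (c :+ e) :- b :* (d :+ f) :=
              (a :* c :- b :* d) :+ (a :* e :- b :* f)) ≡.refl
            (re x n) (im x n) (re y n) (im y n) (re z n) (im z n))
          (λ n → solve 6 (λ a b c d e f →
              a :* (d :+ f) :+ b :* (c :+ e) :=
              (a :* d :+ b :* c) :+ (a :* f :+ b :* e)) ≡.refl
            (re x n) (im x n) (re y n) (im y n) (re z n) (im z n)))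
      , (λ x y z → ≗⇒≈ℂ ((y + z) * x) (y * x + z * x)
          (λ n → solve 6 (λ a b c d e f →
              (c :+ e) :* a :- (d :+ f) :* b :=
              (c :* a :- d :* b) :+ (e :* a :- f :* b)) ≡.refl
            (re x n) (im x n) (re y n) (im y n) (re z n) (im z n))
          (λ n → solve 6 (λ a b c d e f →
              (c :+ e) :* b :+ (d :+ f) :* a :=
              (c :* b :+ d :* a) :+ (e :* b :+ f :* a)) ≡.refl
            (re x n) (im x n) (re y n) (im y n) (re z n) (im z n)))
    }
  }
  where
  open RawRing ℂ using (_+_; _*_; -_; 0#; 1#)
  open +-*-Solver
  re im : RawRing.Carrier ℂ → ℕ → ℚ
  re = seq ∘ proj₁
  im = seq ∘ proj₂
  ≗⇒≈ℂ : ∀ x y → (∀ n → re x n ≡ re y n) → (∀ n → im x n ≡ im y n) →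
         RawRing._≈_ ℂ x y
  ≗⇒≈ℂ (a , b) (c , d) p q = ≗⇒≈ℝ a c p , ≗⇒≈ℝ b d q

-- Invertible elements of a ring

module InvertibleElements {c ℓ} (S : Ring c ℓ) where
  open Ring S
  open SetoidReasoning setoid

  invertible-cong : ∀ {x y} → x ≈ y → Invertible rawRing x → Invertible rawRing y
  invertible-cong x≈y (x⁻¹ , x⁻¹x≈1 , xx⁻¹≈1) =
    x⁻¹ , trans (*-congˡ (sym x≈y)) x⁻¹x≈1 , trans (*-congʳ (sym x≈y)) xx⁻¹≈1

  cancel-middle : ∀ {x y} w z → x * y ≈ 1# → (w * x) * (y * z) ≈ w * z
  cancel-middle {x} {y} w z xy≈1 = begin
    (w * x) * (y * z)  ≈⟨ *-assoc w x (y * z) ⟩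
    w * (x * (y * z))  ≈⟨ *-congˡ (*-assoc x y z) ⟨
    w * ((x * y) * z)  ≈⟨ *-congˡ (*-congʳ xy≈1) ⟩
    w * (1# * z)       ≈⟨ *-congˡ (*-identityˡ z) ⟩
    w * z              ∎

  invertible-* : ∀ {x y} → Invertible rawRing x → Invertible rawRing y →
                 Invertible rawRing (x * y)
  invertible-* {x} {y} (x⁻¹ , x⁻¹x≈1 , xx⁻¹≈1) (y⁻¹ , y⁻¹y≈1 , yy⁻¹≈1) =
    y⁻¹ * x⁻¹ , trans (cancel-middle y⁻¹ y x⁻¹x≈1) y⁻¹y≈1
              , trans (cancel-middle x x⁻¹ yy⁻¹≈1) xx⁻¹≈1

  -- Associativity gives x = x(yz) = (xy)z = z, so `y` is also a left inverse of `x`. For power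
  -- series it is then enough to construct right inverses.
  right-inverses⇒invertible : ∀ {x y z} → x * y ≈ 1# → y * z ≈ 1# → Invertible rawRing x
  right-inverses⇒invertible {x} {y} {z} xy≈1 yz≈1 = y , trans (*-congˡ x≈z) yz≈1 , xy≈1
    where
    x≈z : x ≈ z
    x≈z = begin
      x             ≈⟨ *-identityʳ x ⟨
      x * 1#        ≈⟨ *-congˡ yz≈1 ⟨
      x * (y * z)   ≈⟨ *-assoc x y z ⟨
      (x * y) * z   ≈⟨ *-congʳ xy≈1 ⟩
      1# * z        ≈⟨ *-identityˡ z ⟩
      z             ∎

  -- This is h a h⁻¹ = u (g a g⁻¹) u⁻¹ multiplied by `u` on the right. In that form coefficients can
  -- be compared without knowing those of `u⁻¹`.
  conjugate-by-product : ∀ {h u g g⁻¹ u⁻¹} a → h ≈ u * g → u⁻¹ * u ≈ 1# →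
    ((h * a) * (g⁻¹ * u⁻¹)) * u ≈ u * ((g * a) * g⁻¹)
  conjugate-by-product {h} {u} {g} {g⁻¹} {u⁻¹} a h≈ug u⁻¹u≈1 = begin
    ((h * a) * (g⁻¹ * u⁻¹)) * u  ≈⟨ *-assoc (h * a) (g⁻¹ * u⁻¹) u ⟩
    (h * a) * ((g⁻¹ * u⁻¹) * u)  ≈⟨ *-congˡ (*-assoc g⁻¹ u⁻¹ u) ⟩
    (h * a) * (g⁻¹ * (u⁻¹ * u))  ≈⟨ *-congˡ (*-congˡ u⁻¹u≈1) ⟩
    (h * a) * (g⁻¹ * 1#)         ≈⟨ *-congˡ (*-identityʳ g⁻¹) ⟩
    (h * a) * g⁻¹                ≈⟨ *-congʳ (*-congʳ h≈ug) ⟩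
    ((u * g) * a) * g⁻¹          ≈⟨ *-congʳ (*-assoc u g a) ⟩
    (u * (g * a)) * g⁻¹          ≈⟨ *-assoc u (g * a) g⁻¹ ⟩
    u * ((g * a) * g⁻¹)          ∎

-- Finite sums in a ring

module RingSums {c ℓ} (R : Ring c ℓ) where
  open Ring R hiding (zero)
  open SetoidReasoning setoid
  open Sum semiring public
    using (sum; sum-cong-≋; ∑-comm; ∑-distrib-+; *-distribˡ-sum; *-distribʳ-sum)
  open Sum semiring using (sum-replicate-zero)

  sum-zero : ∀ {n} {f : Vector Carrier n} → (∀ i → f i ≈ 0#) → sum f ≈ 0#
  sum-zero {n} f≈0 = trans (sum-cong-≋ f≈0) (sum-replicate-zero n)

  sum-head : ∀ {n} (f : Vector Carrier (suc n)) → (∀ i → f (suc i) ≈ 0#) → sum f ≈ f zero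
  sum-head f tail≈0 = trans (+-congˡ (sum-zero tail≈0)) (+-identityʳ (f zero))

  sum-tail : ∀ {n} (f : Vector Carrier (suc n)) → f zero ≈ 0# → sum f ≈ sum (f ∘ suc)
  sum-tail f head≈0 = trans (+-congʳ head≈0) (+-identityˡ (sum (f ∘ suc)))

-- Matrices

module Matrices {c ℓ} (R : Ring c ℓ) where
  open Ring R hiding (zero)
  open RingSums R
  open SetoidReasoning setoid

  -- Deleting the first row and column of an identity matrix leaves, definitionally, the smaller
  -- identity matrix, so the induction passes to the tail of the sum.
  sum-identityˡ : ∀ {n} (i : Fin n) (f : Vector Carrier n) →
    sum (λ l → RawRing.1# (matrixRing rawRing n) i l * f l) ≈ f i
  sum-identityˡ {suc n} zero    f = trans
    (sum-head (λ l → RawRing.1# (matrixRing rawRing (suc n)) zero l * f l)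
      (λ l → zeroˡ (f (suc l))))
    (*-identityˡ (f zero))
  sum-identityˡ {suc n} (suc i) f = trans
    (sum-tail (λ l → RawRing.1# (matrixRing rawRing (suc n)) (suc i) l * f l)
      (zeroˡ (f zero)))
    (sum-identityˡ i (f ∘ suc))

  sum-identityʳ : ∀ {n} (j : Fin n) (f : Vector Carrier n) →
    sum (λ l → f l * RawRing.1# (matrixRing rawRing n) l j) ≈ f j
  sum-identityʳ {suc n} zero    f = trans
    (sum-head (λ l → f l * RawRing.1# (matrixRing rawRing (suc n)) l zero)
      (λ l → zeroʳ (f (suc l))))
    (*-identityʳ (f zero))
  sum-identityʳ {suc n} (suc j) f = trans
    (sum-tail (λ l → f l * RawRing.1# (matrixRing rawRing (suc n)) l (suc j))
      (zeroʳ (f zero)))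
    (sum-identityʳ j (f ∘ suc))

  ring : ℕ → Ring c ℓ
  ring n = record
    { Carrier = RawRing.Carrier (matrixRing rawRing n)
    ; _≈_     = RawRing._≈_ (matrixRing rawRing n)
    ; _+_     = RawRing._+_ (matrixRing rawRing n)
    ; _*_     = RawRing._*_ (matrixRing rawRing n)
    ; -_      = RawRing.-_ (matrixRing rawRing n)
    ; 0#      = RawRing.0# (matrixRing rawRing n)
    ; 1#      = RawRing.1# (matrixRing rawRing n)
    ; isRing  = record
      { +-isAbelianGroup = Pointwise.isAbelianGroup (Fin n)
          (Pointwise.isAbelianGroup (Fin n) +-isAbelianGroup)
      ; *-cong = λ A≈B C≈D i j → sum-cong-≋ λ l → *-cong (A≈B i l) (C≈D l j)
      ; *-assoc = λ A B C i j → begin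
          sum (λ l → sum (λ k → A i k * B k l) * C l j)
            ≈⟨ sum-cong-≋ (λ l → *-distribʳ-sum (C l j) (λ k → A i k * B k l)) ⟩
          sum (λ l → sum (λ k → (A i k * B k l) * C l j))
            ≈⟨ ∑-comm (λ l k → (A i k * B k l) * C l j) ⟩
          sum (λ k → sum (λ l → (A i k * B k l) * C l j))
            ≈⟨ sum-cong-≋ (λ k → sum-cong-≋ λ l → *-assoc (A i k) (B k l) (C l j)) ⟩
          sum (λ k → sum (λ l → A i k * (B k l * C l j)))
            ≈⟨ sum-cong-≋ (λ k → *-distribˡ-sum (A i k) (λ l → B k l * C l j)) ⟨
          sum (λ k → A i k * sum (λ l → B k l * C l j)) ∎
      ; *-identity = (λ A i j → sum-identityˡ i (λ l → A l j))
                   , (λ A i j → sum-identityʳ j (A i))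
      ; distrib =
          (λ A B C i j → trans
            (sum-cong-≋ λ l → distribˡ (A i l) (B l j) (C l j))
            (∑-distrib-+ (λ l → A i l * B l j) (λ l → A i l * C l j)))
        , (λ A B C i j → trans
            (sum-cong-≋ λ l → distribʳ (A l j) (B i l) (C i l))
            (∑-distrib-+ (λ l → B i l * A l j) (λ l → C i l * A l j)))
      }
    }

  -- The only nonzero coefficient of row `inject₁ i` is the 1 in column `suc i`, as the diagonal
  -- carries the eigenvalue 0. Without its first row and column the block is the smaller Jordan
  -- block, which gives the induction.
  jordan-shift : ∀ {p} (i : Fin p) (f : Vector Carrier (suc p)) →
    sum (λ l → jordanBlock rawRing (suc p) 0# (inject₁ i) l * f l) ≈ f (suc i)
  jordan-shift {suc p} zero f = begin
    sum term           ≈⟨ sum-tail term (zeroˡ (f zero)) ⟩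
    sum (term ∘ suc)   ≈⟨ sum-head (term ∘ suc) (λ l → zeroˡ (f (suc (suc l)))) ⟩
    1# * f (suc zero)  ≈⟨ *-identityˡ (f (suc zero)) ⟩
    f (suc zero)       ∎
    where
    term : Vector Carrier (suc (suc p))
    term l = jordanBlock rawRing (suc (suc p)) 0# zero l * f l
  jordan-shift {suc p} (suc i) f = trans
    (sum-tail (λ l → jordanBlock rawRing (suc (suc p)) 0# (inject₁ (suc i)) l * f l)
      (zeroˡ (f zero)))
    (jordan-shift i (f ∘ suc))

  -- Rows are counted from 0, so the last row is the one with `suc (toℕ i) ≡ n`.
  SupportedInLastRow : ∀ n → RawRing.Carrier (matrixRing rawRing n) → Set ℓ
  SupportedInLastRow n B = ∀ i j → suc (toℕ i) ≢ n → B i j ≈ 0#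

  SupportedInLastRow-resp-≈ : ∀ {n B C} → RawRing._≈_ (matrixRing rawRing n) B C →
    SupportedInLastRow n B → SupportedInLastRow n C
  SupportedInLastRow-resp-≈ B≈C B-supported i j i≢last =
    trans (sym (B≈C i j)) (B-supported i j i≢last)

  module _ (p : ℕ) where
    open Ring (ring (suc p)) using ()
      renaming (Carrier to Mat; _*_ to _⊛_; _+_ to _⊕_; _-_ to _⊖_)

    J : Mat
    J = jordanBlock rawRing (suc p) 0#

    -- J X is X shifted up by one row, so the rows of X are forced successively
    -- by the equation, starting from an arbitrary first row.
    commutator-solution : (B : Mat) → Σ[ X ∈ Mat ] SupportedInLastRow (suc p) ((B ⊕ X ⊛ J) ⊖ J ⊛ X)
    commutator-solution B = X , vanishing
      where
      -- The iteration advances the starting row and shifts the family `F`, which makes it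
      -- structural in the index; `orbit-suc` recovers the recurrence in which the newest map is
      -- applied last.
      orbit : ∀ {n} → (Fin n → Vector Carrier (suc p) → Vector Carrier (suc p)) →
              Vector Carrier (suc p) → Fin (suc n) → Vector Carrier (suc p)
      orbit         F r zero    = r
      orbit {suc n} F r (suc i) = orbit (F ∘ suc) (F zero r) i

      orbit-suc : ∀ {n} F r (i : Fin n) → orbit F r (suc i) ≡ F i (orbit F r (inject₁ i))
      orbit-suc F r zero    = ≡.refl
      orbit-suc F r (suc i) = orbit-suc (F ∘ suc) (F zero r) i

      -- If `r` is row i of `X`, this is row i of B + XJ. Taking it as row i + 1 of `X`, which is
      -- row i of JX, makes the difference vanish in row i.
      nextRow : Fin p → Vector Carrier (suc p) → Vector Carrier (suc p)
      nextRow i r j = B (inject₁ i) j + sum (λ l → r l * J l j)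

      X : Mat
      X = orbit nextRow (λ _ → 0#)

      vanishing-inject₁ : ∀ i j → ((B ⊕ X ⊛ J) ⊖ J ⊛ X) (inject₁ i) j ≈ 0#
      vanishing-inject₁ i j = begin
        nextRow i (X (inject₁ i)) j - (J ⊛ X) (inject₁ i) j
          ≈⟨ +-congˡ (-‿cong (jordan-shift i (λ l → X l j))) ⟩
        nextRow i (X (inject₁ i)) j - X (suc i) j
          ≡⟨ ≡.cong (λ r → r j - X (suc i) j) (orbit-suc nextRow (λ _ → 0#) i) ⟨
        X (suc i) j - X (suc i) j
          ≈⟨ -‿inverseʳ (X (suc i) j) ⟩
        0# ∎

      vanishing : SupportedInLastRow (suc p) ((B ⊕ X ⊛ J) ⊖ J ⊛ X)
      vanishing i j 1+i≢1+p =
        ≡.subst (λ i → ((B ⊕ X ⊛ J) ⊖ J ⊛ X) i j ≈ 0#)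
          (Fin.inject₁-lower₁ i p≢i) (vanishing-inject₁ (lower₁ i p≢i) j)
        where
        p≢i : p ≢ toℕ i
        p≢i p≡i = 1+i≢1+p (≡.cong suc (≡.sym p≡i))

-- Formal power series

module PowerSeries {c ℓ} (M : Ring c ℓ) where
  open Ring M hiding (zero)
  open RingSums M
  open SetoidReasoning setoid

  open RawRing (powerSeriesRing rawRing) public using ()
    renaming (Carrier to Series; _*_ to _⋆_; 1# to 1ₛ; 0# to 0ₛ)

  tail : Series → Series
  tail a m = a (suc m)

  mono : ℕ → Carrier → Series
  mono = monomial rawRing

  terms : Series → Series → ∀ m → Vector Carrier (suc m)
  terms a b m i = a (toℕ i) * b (m ∸ toℕ i)

  -- Coefficient `m` of a product involves only coefficients of degree at most `m`. This lets a
  -- monomial of higher degree be replaced by zero, and a series by a sufficiently long truncation.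
  ⋆-cong-≤ : ∀ a b u v m → (∀ i → i ≤ m → a i ≈ b i) → (∀ i → i ≤ m → u i ≈ v i) →
             (a ⋆ u) m ≈ (b ⋆ v) m
  ⋆-cong-≤ a b u v m a≈b u≈v = sum-cong-≋ {suc m} {terms a u m} {terms b v m} λ i →
    *-cong (a≈b (toℕ i) (Fin.toℕ≤pred[n] i)) (u≈v (m ∸ toℕ i) (ℕ.m∸n≤m m (toℕ i)))

  ⋆-zero : ∀ a b → (a ⋆ b) 0 ≈ a 0 * b 0
  ⋆-zero a b = +-identityʳ (a 0 * b 0)

  0ₛ-⋆ : ∀ b m → (0ₛ ⋆ b) m ≈ 0#
  0ₛ-⋆ b m = sum-zero {suc m} {terms 0ₛ b m} λ i → zeroˡ (b (m ∸ toℕ i))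

  ⋆-0ₛ : ∀ b m → (b ⋆ 0ₛ) m ≈ 0#
  ⋆-0ₛ b m = sum-zero {suc m} {terms b 0ₛ m} λ i → zeroʳ (b (toℕ i))

  scale-⋆ : ∀ x a b m → ((λ i → x * a i) ⋆ b) m ≈ x * (a ⋆ b) m
  scale-⋆ x a b m = trans
    (sum-cong-≋ {suc m} {terms (λ i → x * a i) b m} {λ i → x * terms a b m i}
      λ i → *-assoc x (a (toℕ i)) (b (m ∸ toℕ i)))
    (sym (*-distribˡ-sum x (terms a b m)))

  ⋆-distribˡ : ∀ a b c m → (a ⋆ (λ i → b i + c i)) m ≈ (a ⋆ b) m + (a ⋆ c) m
  ⋆-distribˡ a b c m = trans
    (sum-cong-≋ {suc m} {terms a (λ i → b i + c i) m} {λ i → terms a b m i + terms a c m i}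
      λ i → distribˡ (a (toℕ i)) (b (m ∸ toℕ i)) (c (m ∸ toℕ i)))
    (∑-distrib-+ (terms a b m) (terms a c m))

  ⋆-distribʳ : ∀ a b c m → ((λ i → b i + c i) ⋆ a) m ≈ (b ⋆ a) m + (c ⋆ a) m
  ⋆-distribʳ a b c m = trans
    (sum-cong-≋ {suc m} {terms (λ i → b i + c i) a m} {λ i → terms b a m i + terms c a m i}
      λ i → distribʳ (a (m ∸ toℕ i)) (b (toℕ i)) (c (toℕ i)))
    (∑-distrib-+ (terms b a m) (terms c a m))

  -- tail (a ⋆ b) = a 0 · tail b + tail a ⋆ b holds definitionally.
  ⋆-assoc : ∀ a b c m → ((a ⋆ b) ⋆ c) m ≈ (a ⋆ (b ⋆ c)) m
  ⋆-assoc a b c zero = begin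
    ((a ⋆ b) ⋆ c) 0      ≈⟨ ⋆-zero (a ⋆ b) c ⟩
    (a ⋆ b) 0 * c 0      ≈⟨ *-congʳ (⋆-zero a b) ⟩
    (a 0 * b 0) * c 0    ≈⟨ *-assoc (a 0) (b 0) (c 0) ⟩
    a 0 * (b 0 * c 0)    ≈⟨ *-congˡ (⋆-zero b c) ⟨
    a 0 * (b ⋆ c) 0      ≈⟨ ⋆-zero a (b ⋆ c) ⟨
    (a ⋆ (b ⋆ c)) 0      ∎
  ⋆-assoc a b c (suc m) = begin
    (a ⋆ b) 0 * c (suc m) + (tail (a ⋆ b) ⋆ c) m
      ≈⟨ +-cong (trans (*-congʳ (⋆-zero a b)) (*-assoc (a 0) (b 0) (c (suc m))))
                (⋆-distribʳ c (λ i → a 0 * tail b i) (tail a ⋆ b) m) ⟩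
    a 0 * (b 0 * c (suc m)) + (((λ i → a 0 * tail b i) ⋆ c) m + ((tail a ⋆ b) ⋆ c) m)
      ≈⟨ +-congˡ (+-cong (scale-⋆ (a 0) (tail b) c m) (⋆-assoc (tail a) b c m)) ⟩
    a 0 * (b 0 * c (suc m)) + (a 0 * (tail b ⋆ c) m + (tail a ⋆ (b ⋆ c)) m)
      ≈⟨ +-assoc _ _ _ ⟨
    (a 0 * (b 0 * c (suc m)) + a 0 * (tail b ⋆ c) m) + (tail a ⋆ (b ⋆ c)) m
      ≈⟨ +-congʳ (distribˡ (a 0) _ _) ⟨
    (a ⋆ (b ⋆ c)) (suc m) ∎

  mono-0-⋆ : ∀ x b m → (mono 0 x ⋆ b) m ≈ x * b m
  mono-0-⋆ x b zero    = ⋆-zero (mono 0 x) b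
  mono-0-⋆ x b (suc m) = trans (+-congˡ (0ₛ-⋆ b m)) (+-identityʳ (x * b (suc m)))

  ⋆-mono-0 : ∀ x b m → (b ⋆ mono 0 x) m ≈ b m * x
  ⋆-mono-0 x b zero    = ⋆-zero b (mono 0 x)
  ⋆-mono-0 x b (suc m) = begin
    b 0 * 0# + (tail b ⋆ mono 0 x) m  ≈⟨ +-cong (zeroʳ (b 0)) (⋆-mono-0 x (tail b) m) ⟩
    0# + b (suc m) * x                ≈⟨ +-identityˡ (b (suc m) * x) ⟩
    b (suc m) * x                     ∎

  ring : Ring c ℓ
  ring = record
    { Carrier = RawRing.Carrier (powerSeriesRing rawRing)
    ; _≈_     = RawRing._≈_ (powerSeriesRing rawRing)
    ; _+_     = RawRing._+_ (powerSeriesRing rawRing)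
    ; _*_     = _⋆_
    ; -_      = RawRing.-_ (powerSeriesRing rawRing)
    ; 0#      = 0ₛ
    ; 1#      = 1ₛ
    ; isRing  = record
      { +-isAbelianGroup = Pointwise.isAbelianGroup ℕ +-isAbelianGroup
      ; *-cong     = λ {a} {b} {u} {v} a≈b u≈v m →
          ⋆-cong-≤ a b u v m (λ i _ → a≈b i) (λ i _ → u≈v i)
      ; *-assoc    = ⋆-assoc
      ; *-identity = (λ b m → trans (mono-0-⋆ 1# b m) (*-identityˡ (b m)))
                   , (λ b m → trans (⋆-mono-0 1# b m) (*-identityʳ (b m)))
      ; distrib    = ⋆-distribˡ , ⋆-distribʳ
      }
    }

  -- Products with monomials of arbitrary degree

  mono-diagonal : ∀ d x → mono d x d ≡ x
  mono-diagonal zero    x = ≡.refl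
  mono-diagonal (suc d) x = mono-diagonal d x

  mono-< : ∀ {d m} x → m < d → mono d x m ≡ 0#
  mono-< {suc d} {zero}  x _         = ≡.refl
  mono-< {suc d} {suc m} x (s≤s m<d) = mono-< x m<d

  mono-⋆-< : ∀ {d m} x b → m < d → (mono d x ⋆ b) m ≈ 0#
  mono-⋆-< {d} {m} x b m<d = trans
    (⋆-cong-≤ (mono d x) 0ₛ b b m
      (λ i i≤m → reflexive (mono-< x (ℕ.≤-<-trans i≤m m<d))) (λ _ _ → refl))
    (0ₛ-⋆ b m)

  ⋆-mono-< : ∀ {d m} x b → m < d → (b ⋆ mono d x) m ≈ 0#
  ⋆-mono-< {d} {m} x b m<d = trans
    (⋆-cong-≤ b b (mono d x) 0ₛ m
      (λ _ _ → refl) (λ i i≤m → reflexive (mono-< x (ℕ.≤-<-trans i≤m m<d))))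
    (⋆-0ₛ b m)

  -- `tail (mono (suc d) x)` is `mono d x`, so each step of the product recursion lowers the degree
  -- of the monomial.
  mono-⋆-diagonal : ∀ d x b → (mono d x ⋆ b) d ≈ x * b 0
  mono-⋆-diagonal zero    x b = ⋆-zero (mono 0 x) b
  mono-⋆-diagonal (suc d) x b = begin
    0# * b (suc d) + (mono d x ⋆ b) d  ≈⟨ +-cong (zeroˡ (b (suc d))) (mono-⋆-diagonal d x b) ⟩
    0# + x * b 0                       ≈⟨ +-identityˡ (x * b 0) ⟩
    x * b 0                            ∎

  -- On this side the recursion shortens `b` and keeps the monomial: the first summand is already
  -- the whole value, and the rest is a coefficient of degree `d` of a product with a monomial of
  -- degree `suc d`.
  ⋆-mono-diagonal : ∀ d x b → (b ⋆ mono d x) d ≈ b 0 * x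
  ⋆-mono-diagonal zero    x b = ⋆-zero b (mono 0 x)
  ⋆-mono-diagonal (suc d) x b = begin
    b 0 * mono d x d + (tail b ⋆ mono (suc d) x) d
      ≈⟨ +-cong (*-congˡ (reflexive (mono-diagonal d x))) (⋆-mono-< x (tail b) (ℕ.n<1+n d)) ⟩
    b 0 * x + 0#
      ≈⟨ +-identityʳ (b 0 * x) ⟩
    b 0 * x ∎

  -- Truncations of the solution of b = 1 - z v b, the inverse of 1 + z v.
  approximateInverse : Series → ℕ → Series
  approximateInverse v t       zero    = 1#
  approximateInverse v zero    (suc m) = 0#
  approximateInverse v (suc t) (suc m) = - (v ⋆ approximateInverse v t) m

  -- Each unfolding lowers both the bound and the degree, so coefficient `m` no longer changes once
  -- the bound has reached `m`.
  approximateInverse-stable : ∀ v {s t m} → m ≤ s → m ≤ t →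
    approximateInverse v s m ≈ approximateInverse v t m
  approximateInverse-stable v {m = zero}              _         _         = refl
  approximateInverse-stable v {suc s} {suc t} {suc m} (s≤s m≤s) (s≤s m≤t) =
    -‿cong (⋆-cong-≤ v v (approximateInverse v s) (approximateInverse v t) m
      (λ _ _ → refl) λ i i≤m →
      approximateInverse-stable v (ℕ.≤-trans i≤m m≤s) (ℕ.≤-trans i≤m m≤t))

  -- Coefficient `m` is read off at bound `m`, where it has become stable. Only `tail u` enters,
  -- since `u` is read as 1 + z (`tail u`); hence the hypothesis on `u 0` in `inverseʳ`.
  inverse : Series → Series
  inverse u m = approximateInverse (tail u) m m

  inverseʳ : ∀ u → u 0 ≈ 1# → ∀ m → (u ⋆ inverse u) m ≈ 1ₛ m
  inverseʳ u u₀≈1 zero = begin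
    (u ⋆ inverse u) 0  ≈⟨ ⋆-zero u (inverse u) ⟩
    u 0 * 1#           ≈⟨ *-identityʳ (u 0) ⟩
    u 0                ≈⟨ u₀≈1 ⟩
    1#                 ∎
  inverseʳ u u₀≈1 (suc m) = begin
    u 0 * - x + (tail u ⋆ inverse u) m
      -- The coefficient `- x` was built from the approximation with bound `m`, while the remaining
      -- sum takes coefficient i at bound i. Stability identifies the two, and they cancel.
      ≈⟨ +-cong (trans (*-congʳ u₀≈1) (*-identityˡ (- x)))
                (⋆-cong-≤ (tail u) (tail u) (inverse u) (approximateInverse (tail u) m) m
                  (λ _ _ → refl)
                  λ i i≤m → approximateInverse-stable (tail u) ℕ.≤-refl i≤m) ⟩
    - x + x
      ≈⟨ -‿inverseˡ x ⟩
    0# ∎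
    where
    x : Carrier
    x = (tail u ⋆ approximateInverse (tail u) m) m

  -- The constant term of `inverse u` is 1 by definition, so the construction of right inverses
  -- applies to it again.
  unipotent-invertible : ∀ u → u 0 ≈ 1# → Invertible (powerSeriesRing rawRing) u
  unipotent-invertible u u₀≈1 =
    InvertibleElements.right-inverses⇒invertible ring {u} {inverse u} {inverse (inverse u)}
      (inverseʳ u u₀≈1) (inverseʳ (inverse u) refl)

-- Normal forms under gauge transformations

-- Reconciles `insertAt`, whose old entries are found through `punchIn`, with `init`, which is
-- indexed through `inject₁`.
punchIn-fromℕ : ∀ n (i : Fin n) → punchIn (fromℕ n) i ≡ inject₁ i
punchIn-fromℕ (suc n) zero    = ≡.refl
punchIn-fromℕ (suc n) (suc i) = ≡.cong suc (punchIn-fromℕ n i)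

-- Every b can be moved into N by adding a commutator [x , J].
module GaugeNormalForm {c ℓ p} (M : Ring c ℓ) (J : Ring.Carrier M)
  (N : Ring.Carrier M → Set p)
  (N-resp-≈ : ∀ {x y} → Ring._≈_ M x y → N x → N y)
  (reduce : ∀ b → Σ[ x ∈ Ring.Carrier M ]
    N (Ring._-_ M (Ring._+_ M b (Ring._*_ M x J)) (Ring._*_ M J x)))
  where
  open Ring M hiding (zero)
  open PowerSeries M renaming (ring to Mz)
  open SetoidReasoning setoid
  private
    module Mz = Ring Mz
    module Mz-invertible = InvertibleElements Mz

  -- Vectors are functions, and `init` of an extended vector is known to agree with the original
  -- only pointwise.
  gaugeProduct-cong : ∀ {k} x {g h : Vector Carrier k} → (∀ i → g i ≡ h i) →
    gaugeProduct rawRing x g Mz.≈ gaugeProduct rawRing x h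
  gaugeProduct-cong {zero}  x g≗h = Mz.refl {mono 0 x}
  gaugeProduct-cong {suc k} x {g} {h} g≗h rewrite g≗h (fromℕ k) =
    Mz.*-congˡ {factor} {gaugeProduct rawRing x (init g)} {gaugeProduct rawRing x (init h)}
      (gaugeProduct-cong x (g≗h ∘ inject₁))
    where
    factor : Series
    factor = 1ₛ Mz.+ mono (suc k) (last h)

  gaugeProduct-insertAt : ∀ {k} x (g : Vector Carrier k) y →
    gaugeProduct rawRing x (insertAt g (fromℕ k) y) Mz.≈
    (1ₛ Mz.+ mono (suc k) y) ⋆ gaugeProduct rawRing x g
  gaugeProduct-insertAt {k} x g y rewrite insertAt-lookup g (fromℕ k) y =
    Mz.*-congˡ {factor} {gaugeProduct rawRing x (init (insertAt g (fromℕ k) y))}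
      {gaugeProduct rawRing x g}
      (gaugeProduct-cong x λ i → ≡.trans
        (≡.cong (insertAt g (fromℕ k) y) (≡.sym (punchIn-fromℕ k i)))
        (insertAt-punchIn g (fromℕ k) y i))
    where
    factor : Series
    factor = 1ₛ Mz.+ mono (suc k) y

  mono-0-invertible : ∀ {x} → Invertible rawRing x →
                      Invertible (powerSeriesRing rawRing) (mono 0 x)
  mono-0-invertible {x} (x⁻¹ , x⁻¹x≈1 , xx⁻¹≈1) =
    mono 0 x⁻¹ , mono-0-inverse x⁻¹ x x⁻¹x≈1 , mono-0-inverse x x⁻¹ xx⁻¹≈1
    where
    mono-0-inverse : ∀ x y → x * y ≈ 1# → mono 0 x ⋆ mono 0 y Mz.≈ 1ₛ
    mono-0-inverse x y xy≈1 zero    = trans (mono-0-⋆ x (mono 0 y) 0) xy≈1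
    mono-0-inverse x y xy≈1 (suc m) = trans (mono-0-⋆ x (mono 0 y) (suc m)) (zeroʳ x)

  -- Below degree `d` the monomial contributes to neither product, and only the factor 1 acts.
  intertwined-< : ∀ {d m} x b b′ → b′ ⋆ (1ₛ Mz.+ mono d x) Mz.≈ (1ₛ Mz.+ mono d x) ⋆ b →
                  m < d → b′ m ≈ b m
  intertwined-< {d} {m} x b b′ intertwined m<d = begin
    b′ m                             ≈⟨ +-identityʳ (b′ m) ⟨
    b′ m + 0#                        ≈⟨ +-cong (Mz.*-identityʳ b′ m) (⋆-mono-< x b′ m<d) ⟨
    (b′ ⋆ 1ₛ) m + (b′ ⋆ mono d x) m  ≈⟨ ⋆-distribˡ b′ 1ₛ (mono d x) m ⟨
    (b′ ⋆ (1ₛ Mz.+ mono d x)) m      ≈⟨ intertwined m ⟩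
    ((1ₛ Mz.+ mono d x) ⋆ b) m       ≈⟨ ⋆-distribʳ b 1ₛ (mono d x) m ⟩
    (1ₛ ⋆ b) m + (mono d x ⋆ b) m    ≈⟨ +-cong (Mz.*-identityˡ b m) (mono-⋆-< x b m<d) ⟩
    b m + 0#                         ≈⟨ +-identityʳ (b m) ⟩
    b m                              ∎

  -- Coefficient `d` of the two products gives b′ d + b′ 0 x = b d + x b 0, which is solved for b′
  -- d.
  intertwined-diagonal : ∀ {d} x b b′ →
    b′ ⋆ (1ₛ Mz.+ mono d x) Mz.≈ (1ₛ Mz.+ mono d x) ⋆ b →
    b′ d ≈ (b d + x * b 0) - b′ 0 * x
  intertwined-diagonal {d} x b b′ intertwined = begin
    b′ d
      ≈⟨ +-identityʳ (b′ d) ⟨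
    b′ d + 0#
      ≈⟨ +-congˡ (-‿inverseʳ (b′ 0 * x)) ⟨
    b′ d + (b′ 0 * x - b′ 0 * x)
      ≈⟨ +-assoc (b′ d) (b′ 0 * x) (- (b′ 0 * x)) ⟨
    (b′ d + b′ 0 * x) - b′ 0 * x
      ≈⟨ +-congʳ (+-cong (Mz.*-identityʳ b′ d) (⋆-mono-diagonal d x b′)) ⟨
    ((b′ ⋆ 1ₛ) d + (b′ ⋆ mono d x) d) - b′ 0 * x
      ≈⟨ +-congʳ (⋆-distribˡ b′ 1ₛ (mono d x) d) ⟨
    (b′ ⋆ (1ₛ Mz.+ mono d x)) d - b′ 0 * x
      ≈⟨ +-congʳ (intertwined d) ⟩
    ((1ₛ Mz.+ mono d x) ⋆ b) d - b′ 0 * x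
      ≈⟨ +-congʳ (⋆-distribʳ b 1ₛ (mono d x) d) ⟩
    ((1ₛ ⋆ b) d + (mono d x ⋆ b) d) - b′ 0 * x
      ≈⟨ +-congʳ (+-cong (Mz.*-identityˡ b d) (mono-⋆-diagonal d x b)) ⟩
    (b d + x * b 0) - b′ 0 * x ∎

  NormalUpTo : ℕ → Series → Set _
  NormalUpTo k b = b 0 ≈ J × (∀ l → 1 ≤ l → l ≤ k → N (b l))

  gauge-normal-form : (a : Series) (x : Carrier) (x-inv : Invertible rawRing x) →
    x * a 0 * proj₁ x-inv ≈ J → (k : ℕ) →
    Σ[ g ∈ Vector Carrier k ]
    Σ[ inv ∈ Invertible (powerSeriesRing rawRing) (gaugeProduct rawRing x g) ]
      NormalUpTo k (gaugeProduct rawRing x g ⋆ a ⋆ proj₁ inv)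
  gauge-normal-form a x x-inv xax⁻¹≈J zero =
    (λ ()) , mono-0-invertible x-inv , b₀≈J , λ { zero () _ ; (suc l) _ () }
    where
    x⁻¹ : Carrier
    x⁻¹ = proj₁ x-inv
    b₀≈J : (mono 0 x ⋆ a ⋆ mono 0 x⁻¹) 0 ≈ J
    b₀≈J = trans (⋆-mono-0 x⁻¹ (mono 0 x ⋆ a) 0)
                 (trans (*-congʳ (mono-0-⋆ x a 0)) xax⁻¹≈J)
  gauge-normal-form a x x-inv xax⁻¹≈J (suc k)
    with gauge-normal-form a x x-inv xax⁻¹≈J k
  ... | g , (G⁻¹ , G⁻¹-inverse) , b₀≈J , b-normal =
    g′ , inv′ , trans (b′≈b (s≤s z≤n)) b₀≈J , b′-normal
    where
    G b : Series
    G = gaugeProduct rawRing x g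
    b = G ⋆ a ⋆ G⁻¹

    y : Carrier
    -- The new factor has to correct the coefficient of degree k + 1, the first one on which the
    -- induction hypothesis is silent.
    y = proj₁ (reduce (b (suc k)))

    u : Series
    u = 1ₛ Mz.+ mono (suc k) y

    u-inv : Invertible (powerSeriesRing rawRing) u
    -- The monomial has positive degree, so the constant term of `u` is 1 + 0.
    u-inv = unipotent-invertible u (+-identityʳ 1#)

    u⁻¹ : Series
    u⁻¹ = proj₁ u-inv

    g′ : Vector Carrier (suc k)
    g′ = insertAt g (fromℕ k) y

    G′ : Series
    G′ = gaugeProduct rawRing x g′

    inv′ : Invertible (powerSeriesRing rawRing) G′
    inv′ = Mz-invertible.invertible-cong {u ⋆ G} {G′}
      (Mz.sym {G′} {u ⋆ G} (gaugeProduct-insertAt x g y))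
      (Mz-invertible.invertible-* {u} {G} u-inv (G⁻¹ , G⁻¹-inverse))

    b′ : Series
    -- `invertible-cong` keeps the inverse that `invertible-*` gives for `u ⋆ G`, so `G⁻¹ ⋆ u⁻¹` is
    -- by definition the first component of `inv′`.
    b′ = G′ ⋆ a ⋆ (G⁻¹ ⋆ u⁻¹)

    intertwined : b′ ⋆ u Mz.≈ u ⋆ b
    intertwined = Mz-invertible.conjugate-by-product {G′} {u} {G} {G⁻¹} {u⁻¹} a
      (gaugeProduct-insertAt x g y) (proj₁ (proj₂ u-inv))

    b′≈b : ∀ {m} → m < suc k → b′ m ≈ b m
    b′≈b = intertwined-< y b b′ intertwined

    reduced≈b′ : (b (suc k) + y * J) - J * y ≈ b′ (suc k)
    -- Both constant terms `b 0` and `b′ 0` equal `J`, so the correction in degree k + 1 is exactly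
    -- the commutator for which `reduce` chose `y`.
    reduced≈b′ = sym (trans (intertwined-diagonal y b b′ intertwined)
      (+-cong (+-congˡ (*-congˡ b₀≈J))
              (-‿cong (*-congʳ (trans (b′≈b (s≤s z≤n)) b₀≈J)))))

    b′-normal : ∀ l → 1 ≤ l → l ≤ suc k → N (b′ l)
    -- Degrees up to `k` inherit normality from `b`; degree k + 1 is normal by the choice of `y`.
    b′-normal l 1≤l l≤1+k with ℕ.m≤n⇒m<n∨m≡n l≤1+k
    ... | inj₁ l<1+k  = N-resp-≈ (sym (b′≈b l<1+k)) (b-normal l 1≤l (ℕ.≤-pred l<1+k))
    ... | inj₂ ≡.refl = N-resp-≈ reduced≈b′ (proj₂ (reduce (b (suc k))))

-- The raw ring is a separate parameter, so that instantiating the lemma does not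
-- compare ℂ with a projection of its ring structure.
module JordanNormalForm {c ℓ} (R : RawRing c ℓ)
  (isRing : IsRing (RawRing._≈_ R) (RawRing._+_ R) (RawRing._*_ R)
                   (RawRing.-_ R) (RawRing.0# R) (RawRing.1# R))
  (p : ℕ) where
  private
    module R = RawRing R
    module Mat = RawRing (matrixRing R (suc p))
    module Series = RawRing (powerSeriesRing (matrixRing R (suc p)))

  entries : Ring c ℓ
  entries = record { isRing = isRing }

  open Matrices entries using
    (ring; J; SupportedInLastRow; SupportedInLastRow-resp-≈; commutator-solution)
  open GaugeNormalForm (ring (suc p)) (J p) (SupportedInLastRow (suc p))
    (λ {B} {C} → SupportedInLastRow-resp-≈ {suc p} {B} {C}) (commutator-solution p)
    using (gauge-normal-form)

  jordan-normal-form :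
    (A : Series.Carrier) → Similar R (suc p) (A 0) (jordanBlock R (suc p) R.0#) →
    (k : ℕ) →
    Σ[ g₀ ∈ Mat.Carrier ] Invertible (matrixRing R (suc p)) g₀ ×
    (Σ[ g ∈ Vector Mat.Carrier k ]
     Σ[ inv ∈ Invertible (powerSeriesRing (matrixRing R (suc p)))
                (gaugeProduct (matrixRing R (suc p)) g₀ g) ]
      let B = gaugeProduct (matrixRing R (suc p)) g₀ g Series.* A Series.* proj₁ inv in
      B 0 Mat.≈ jordanBlock R (suc p) R.0# ×
      ((l : ℕ) → 1 ≤ l → l ≤ k →
       (i j : Fin (suc p)) → suc (toℕ i) ≢ suc p → B l i j R.≈ R.0#))
  jordan-normal-form A (P , P-inv , PAP⁻¹≈J) k =
    -- The matrix of the given similarity serves as the constant factor.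
    P , P-inv , gauge-normal-form A P P-inv PAP⁻¹≈J k

-- Specialisation to complex matrices

theorem2p1 :
    (n : ℕ) → 1 ≤ n →
    let Mₙ = matrixRing ℂ n
        Mₙ⟦z⟧ = powerSeriesRing Mₙ
        open RawRing Mₙ⟦z⟧ using (_*_)
        0ℂ = RawRing.0# ℂ
    in
    (A : RawRing.Carrier Mₙ⟦z⟧) →
    Similar ℂ n (A 0) (jordanBlock ℂ n 0ℂ) →
    (k : ℕ) → 1 ≤ k →
    Σ[ g₀ ∈ RawRing.Carrier Mₙ ] Invertible Mₙ g₀ ×
    (Σ[ g ∈ Vector (RawRing.Carrier Mₙ) k ]
     Σ[ inv ∈ Invertible Mₙ⟦z⟧ (gaugeProduct Mₙ g₀ g) ]
      let B = gaugeProduct Mₙ g₀ g * A * proj₁ inv in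
      RawRing._≈_ Mₙ (B 0) (jordanBlock ℂ n 0ℂ) ×
      ((l : ℕ) → 1 ≤ l → l ≤ k →
       (i j : Fin n) → suc (toℕ i) ≢ n →
       RawRing._≈_ ℂ (B l i j) 0ℂ))
-- With the size written as `suc p`, the `p` rows `inject₁ i` are exactly those above the last.
theorem2p1 (suc p) _ A A₀∼J k _ =
  JordanNormalForm.jordan-normal-form ℂ (Ring.isRing ℂ-ring) p A A₀∼J k
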